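{- There exists an absolute constant $C>0$ such that for every integer $d\ge 2$, every natural number $n\in\{0,1,2,\ldots\}$ is the sum of at most $C\,d$ palindromes in base $d$ (repetitions allowed).
   Context: $\mathbb{N}=\{0,1,2,\ldots\}$. For an integer $d\ge 2$, every $n\in\mathbb{N}$ has a unique base-$d$ representation $n=\sum_{j=0}^{l-1} d^j\delta_j$ with $l\ge 1$, digits $\delta_j\in\{0,1,\ldots,d-1\}$, and leading digit $\delta_{l-1}\neq 0$ whenever $l\ge 2$. The number $n$ is a palindrome in base $d$ if, in this representation, $\delta_j=\delta_{l-1-j}$ for all $0\le j<l$. In particular $0$ is a palindrome. -}

module Defs where

open import Data.Digit using (Digit; fromDigits)
open import Data.Fin.Base using (toℕ; opposite)
open import Data.List.Base using (length)
open import Data.List.Relation.Unary.All using (All)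
open import Data.Nat.Base using (ℕ; suc; _≤_)
open import Data.Nat.ListAction using (sum)
open import Data.Product.Base using (∃-syntax; _×_)
open import Data.Vec.Base using (Vec; last; lookup; toList)
open import Relation.Binary.PropositionalEquality using (_≡_; _≢_)

-- Digits are listed least significant first, as `fromDigits` expects, so
-- `lookup δ j` is the coefficient of d ^ j and `last δ` is the leading digit.
-- The length l = suc k is at least 1; the leading digit may be 0 only if l = 1.

record IsRepresentation (d n : ℕ) {k : ℕ} (δ : Vec (Digit d) (suc k)) : Set where
  field
    value     : fromDigits (toList δ) ≡ n
    leading≢0 : 2 ≤ suc k → toℕ (last δ) ≢ 0

-- For j : Fin l, `opposite j` is the index l - 1 - j.

IsPalindrome : (d n : ℕ) → Set
IsPalindrome d n =
  ∃[ k ] ∃[ δ ] IsRepresentation d n {k} δ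
              × (∀ j → lookup δ j ≡ lookup δ (opposite j))

IsSumOfAtMostPalindromes : (d m n : ℕ) → Set
IsSumOfAtMostPalindromes d m n =
  ∃[ ps ] length ps ≤ m × All (IsPalindrome d) ps × sum ps ≡ n

{-# OPTIONS --safe #-}

-- A sum of 3d palindromes of length k with all digits 0 or 1, leading zeros
-- allowed, is an arbitrary Σ cⱼ (d^j + d^(k-1-j)) with 0 ≤ cⱼ ≤ 3d.  Adding such
-- a sum for length k to one for length k + 1 reaches every number in
-- [2 d^k, 3 d^(k+1)], by induction from k to k + 2: one of the two new
-- outermost coefficients is chosen greedily by size, the other to make the
-- remainder divisible by d.  Surrounding all the summands by digits 1 turns them
-- into genuine palindromes, whose sums together with fewer than d ones fill an
-- interval of length at least d^(k+2).  Every n between two consecutive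
-- thresholds 14 d^(k+3) is brought into it by subtracting at most 15d
-- palindromes of the form 1 + d^j.
module Submission where

open import Defs
open import Data.Nat.Base using (ℕ; _*_; _≤_; _<_)
open import Data.Product.Base using (∃-syntax; _×_)

open import Data.Digit using (Digit; fromDigits)
open import Data.Fin.Base using (zero; suc; toℕ; fromℕ; fromℕ<; inject₁; opposite)
open import Data.Fin.Properties using (toℕ-fromℕ<)
open import Data.List.Base using (length; []; _∷_)
open import Data.List.Relation.Unary.All using (All; []; _∷_)
open import Data.Nat.Base using (zero; suc; _+_; _∸_; _^_; _/_; _%_; z≤n; s≤s; NonZero; >-nonZero)
open import Data.Nat.DivMod
open import Data.Nat.ListAction using (sum)
open import Data.Nat.Properties
open import Data.Nat.Tactic.RingSolver using (solve-∀)
open import Data.Product.Base using (_,_; ∃₂)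
open import Data.Sum.Base using (_⊎_; inj₁; inj₂)
open import Data.Vec.Base using (Vec; []; _∷_; _∷ʳ_; last; lookup; reverse; toList)
open import Data.Vec.Properties using (reverse-∷; last-∷ʳ)
open import Relation.Binary.PropositionalEquality using (_≡_; _≢_; refl; sym; trans; cong; subst; module ≡-Reasoning)
open import Relation.Nullary using (yes; no)

-- Reversal of digit strings and the value of an appended digit.

lookup-∷ʳ-fromℕ : ∀ {A : Set} {n} (xs : Vec A n) x → lookup (xs ∷ʳ x) (fromℕ n) ≡ x
lookup-∷ʳ-fromℕ []       x = refl
lookup-∷ʳ-fromℕ (_ ∷ xs) x = lookup-∷ʳ-fromℕ xs x

lookup-∷ʳ-inject₁ : ∀ {A : Set} {n} (xs : Vec A n) x i → lookup (xs ∷ʳ x) (inject₁ i) ≡ lookup xs i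
lookup-∷ʳ-inject₁ (_ ∷ xs) x zero    = refl
lookup-∷ʳ-inject₁ (_ ∷ xs) x (suc i) = lookup-∷ʳ-inject₁ xs x i

-- Bridge between two forms of symmetry: `reverse v ≡ v`, which is easy to carry through an
-- induction, and the index-wise condition in `IsPalindrome`.
lookup-reverse-opposite : ∀ {A : Set} {n} (xs : Vec A n) i → lookup (reverse xs) (opposite i) ≡ lookup xs i
lookup-reverse-opposite (x ∷ xs) zero    rewrite reverse-∷ x xs = lookup-∷ʳ-fromℕ (reverse xs) x
lookup-reverse-opposite (x ∷ xs) (suc i) rewrite reverse-∷ x xs =
  trans (lookup-∷ʳ-inject₁ (reverse xs) x (opposite i)) (lookup-reverse-opposite xs i)

reverse-∷ʳ : ∀ {A : Set} {n} (xs : Vec A n) x → reverse (xs ∷ʳ x) ≡ x ∷ reverse xs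
reverse-∷ʳ []       x = refl
reverse-∷ʳ (y ∷ xs) x = begin
  reverse (y ∷ (xs ∷ʳ x))  ≡⟨ reverse-∷ y (xs ∷ʳ x) ⟩
  reverse (xs ∷ʳ x) ∷ʳ y   ≡⟨ cong (_∷ʳ y) (reverse-∷ʳ xs x) ⟩
  x ∷ (reverse xs ∷ʳ y)    ≡⟨ cong (x ∷_) (sym (reverse-∷ y xs)) ⟩
  x ∷ reverse (y ∷ xs)     ∎
  where open ≡-Reasoning

fromDigits-∷ʳ : ∀ {b n} (v : Vec (Digit b) n) a →
                fromDigits (toList (v ∷ʳ a)) ≡ fromDigits (toList v) + toℕ a * b ^ n
fromDigits-∷ʳ         []      a = trans (+-identityʳ (toℕ a)) (sym (*-identityʳ (toℕ a)))
fromDigits-∷ʳ {b} {suc n} (x ∷ v) a =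
  trans (cong (λ s → toℕ x + s * b) (fromDigits-∷ʳ v a))
        (rearrange (toℕ x) (fromDigits (toList v)) (toℕ a) (b ^ n) b)
  where
  rearrange : ∀ x s a p b → x + (s + a * p) * b ≡ x + s * b + a * (b * p)
  rearrange = solve-∀

-- Palindromic strings of fixed length, leading zeros allowed.

Padded : (b k x : ℕ) → Set
Padded b k x = ∃[ v ] reverse v ≡ v × fromDigits (toList {A = Digit b} {n = k} v) ≡ x

private
  surround : ∀ {b k} → Digit b → Vec (Digit b) k → Vec (Digit b) (2 + k)
  surround a v = a ∷ (v ∷ʳ a)

  reverse-surround : ∀ {b k} (a : Digit b) (v : Vec (Digit b) k) → reverse v ≡ v →
                     reverse (surround a v) ≡ surround a v
  reverse-surround a v eq = begin
    reverse (a ∷ (v ∷ʳ a))  ≡⟨ reverse-∷ a (v ∷ʳ a) ⟩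
    reverse (v ∷ʳ a) ∷ʳ a   ≡⟨ cong (_∷ʳ a) (reverse-∷ʳ v a) ⟩
    a ∷ (reverse v ∷ʳ a)    ≡⟨ cong (surround a) eq ⟩
    a ∷ (v ∷ʳ a)            ∎
    where open ≡-Reasoning

  fromDigits-surround : ∀ {b k} (a : Digit b) (v : Vec (Digit b) k) →
    fromDigits (toList (surround a v)) ≡ toℕ a * suc (b ^ suc k) + fromDigits (toList v) * b
  fromDigits-surround {b} {k} a v =
    trans (cong (λ s → toℕ a + s * b) (fromDigits-∷ʳ v a))
          (rearrange (toℕ a) (fromDigits (toList v)) (b ^ k) b)
    where
    rearrange : ∀ a s p b → a + (s + a * p) * b ≡ a * suc (b * p) + s * b
    rearrange = solve-∀

Padded-surround : ∀ {b k x} (a : Digit b) → Padded b k x →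
                  Padded b (2 + k) (toℕ a * suc (b ^ suc k) + x * b)
Padded-surround a (v , rev , refl) =
  surround a v , reverse-surround a v rev , fromDigits-surround a v

surround-isPalindrome : ∀ {b k x} (a : Digit b) → toℕ a ≢ 0 → Padded b k x →
                        IsPalindrome b (toℕ a * suc (b ^ suc k) + x * b)
surround-isPalindrome {k = k} a a≢0 (v , rev , refl) =
  -- The string has length `2 + k`; `IsPalindrome` stores the length minus one.
  suc k , w , record { value = fromDigits-surround a v ; leading≢0 = λ _ → leading } , mirrored
  where
  w = surround a v
  leading : toℕ (last w) ≢ 0
  leading rewrite last-∷ʳ a (a ∷ v) = a≢0
  mirrored : ∀ j → lookup w j ≡ lookup w (opposite j)
  mirrored j = trans (sym (lookup-reverse-opposite w j))
                     (cong (λ u → lookup u (opposite j)) (reverse-surround a v rev))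

-- Sums with a recorded number of terms.

data SumOf (P : ℕ → Set) : ℕ → ℕ → Set where
  []  : SumOf P 0 0
  _∷_ : ∀ {x m n} → P x → SumOf P m n → SumOf P (suc m) (x + n)

SumOf-replicate : ∀ {P x} m → P x → SumOf P m (m * x)
SumOf-replicate zero    px = []
SumOf-replicate (suc m) px = px ∷ SumOf-replicate m px

infixr 5 _++ₛ_

_++ₛ_ : ∀ {P m m′ n n′} → SumOf P m n → SumOf P m′ n′ → SumOf P (m + m′) (n + n′)
[]                      ++ₛ qs = qs
_++ₛ_ {n′ = n′} (_∷_ {x} {n = n} px ps) qs =
  subst (SumOf _ _) (sym (+-assoc x n n′)) (px ∷ (ps ++ₛ qs))

SumOf⇒palindromes : ∀ {d m n} → SumOf (IsPalindrome d) m n →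
               ∃[ ps ] length ps ≡ m × All (IsPalindrome d) ps × sum ps ≡ n
SumOf⇒palindromes []             = [] , refl , [] , refl
SumOf⇒palindromes (_∷_ {x} p ps) with SumOf⇒palindromes ps
... | xs , len , all , eq = x ∷ xs , cong suc len , p ∷ all , cong (x +_) eq

module _ {P Q : ℕ → Set} (c b : ℕ) where

  -- The first `a` terms take the route `g`, the others `f`. With `c` equal to `1 + d^(k+1)` and `b`
  -- equal to `d`, this puts digits 1 around `a` of the strings and digits 0 around the rest, so a
  -- new outermost coefficient `a` appears.
  distribute : (∀ {x} → P x → Q (x * b)) → (∀ {x} → P x → Q (c + x * b)) →
               ∀ {m n a} → a ≤ m → SumOf P m n → SumOf Q m (a * c + n * b)
  distribute f g z≤n [] = []
  distribute f g z≤n (_∷_ {x} {n = n} p ps) =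
    subst (SumOf Q _) (sym (*-distribʳ-+ b x n)) (f p ∷ distribute f g z≤n ps)
  distribute f g (s≤s {a} a≤m) (_∷_ {x} {n = n} p ps) =
    subst (SumOf Q _) (rearrange c x a n b) (g p ∷ distribute f g a≤m ps)
    where
    rearrange : ∀ c x a n b → c + x * b + (a * c + n * b) ≡ c + a * c + (x + n) * b
    rearrange = solve-∀

  -- All terms receive outer digits 1. This variant serves targets such as genuine palindromes,
  -- where outer digits 0 are not allowed.
  increment : (∀ {x} → P x → Q (c + x * b)) →
              ∀ {m n} → SumOf P m n → SumOf Q m (m * c + n * b)
  increment g [] = []
  increment g (_∷_ {x} {m} {n} p ps) =
    subst (SumOf Q _) (rearrange c x m n b) (g p ∷ increment g ps)
    where
    rearrange : ∀ c x m n b → c + x * b + (m * c + n * b) ≡ c + m * c + (x + n) * b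
    rearrange = solve-∀

-- Arithmetic preliminaries.

bracket : ∀ (f : ℕ → ℕ) k n → n < f k → n < f 0 ⊎ ∃[ j ] f j ≤ n × n < f (suc j)
bracket f zero    n n<f = inj₁ n<f
bracket f (suc k) n n<f with f k ≤? n
... | yes fk≤n = inj₂ (k , fk≤n , n<f)
... | no  fk≰n = bracket f k n (≰⇒> fk≰n)

n<m^n : ∀ m → 2 ≤ m → ∀ n → n < m ^ n
n<m^n m 2≤m zero    = s≤s z≤n
n<m^n m 2≤m (suc n) = begin-strict
  suc n              ≤⟨ n<m^n m 2≤m n ⟩
  m ^ n              <⟨ m<m+n (m ^ n) (≤-trans (s≤s z≤n) (n<m^n m 2≤m n)) ⟩
  m ^ n + m ^ n      ≡⟨ cong (m ^ n +_) (sym (+-identityʳ (m ^ n))) ⟩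
  2 * m ^ n          ≤⟨ *-monoˡ-≤ (m ^ n) 2≤m ⟩
  m * m ^ n          ∎
  where open ≤-Reasoning

-- Sizes are measured in powers `d^j`, but the divisors that occur are `1 + d^j`; this bounds the
-- resulting quotients.
m≤n*o⇒m/suc[o]≤n : ∀ m n o → m ≤ n * o → m / suc o ≤ n
m≤n*o⇒m/suc[o]≤n m n o m≤no = ≤-pred (m<n*o⇒m/o<n (begin-strict
  m              ≤⟨ m≤no ⟩
  n * o          ≤⟨ *-monoʳ-≤ n (n≤1+n o) ⟩
  n * suc o      <⟨ m<n+m (n * suc o) (s≤s z≤n) ⟩
  suc n * suc o  ∎))
  where open ≤-Reasoning

-- Basic palindromes in a fixed base.

module Base (d : ℕ) (2≤d : 2 ≤ d) where

  instance
    d≢0 : NonZero d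
    d≢0 = >-nonZero (≤-trans (s≤s z≤n) 2≤d)

  0d 1d : Digit d
  0d = fromℕ< (≤-trans (s≤s z≤n) 2≤d)
  1d = fromℕ< 2≤d

  toℕ-0d : toℕ 0d ≡ 0
  toℕ-0d = toℕ-fromℕ< _

  toℕ-1d : toℕ 1d ≡ 1
  toℕ-1d = toℕ-fromℕ< _

  1d≢0 : toℕ 1d ≢ 0
  1d≢0 eq = 1+n≢0 (trans (sym toℕ-1d) eq)

  Pal : ℕ → Set
  Pal = IsPalindrome d

  surround₀ : ∀ {k x} → Padded d k x → Padded d (2 + k) (x * d)
  surround₀ {k} {x} p = subst (λ a → Padded d (2 + k) (a * suc (d ^ suc k) + x * d)) toℕ-0d (Padded-surround 0d p)

  surround₁ : ∀ {k x} → Padded d k x → Padded d (2 + k) (suc (d ^ suc k) + x * d)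
  surround₁ {k} {x} p = subst (λ c → Padded d (2 + k) (c + x * d)) (*-identityˡ _)
    (subst (λ a → Padded d (2 + k) (a * suc (d ^ suc k) + x * d)) toℕ-1d (Padded-surround 1d p))

  Pal-surround₁ : ∀ {k x} → Padded d k x → Pal (suc (d ^ suc k) + x * d)
  Pal-surround₁ {k} {x} p = subst (λ c → Pal (c + x * d)) (*-identityˡ _)
    (subst (λ a → Pal (a * suc (d ^ suc k) + x * d)) toℕ-1d (surround-isPalindrome 1d 1d≢0 p))

  Padded-[_] : ∀ (a : Digit d) → Padded d 1 (toℕ a)
  Padded-[ a ] = a ∷ [] , refl , +-identityʳ (toℕ a)

  Padded-0 : ∀ k → Padded d k 0
  Padded-0 zero          = [] , refl , refl
  Padded-0 (suc zero)    = subst (Padded d 1) toℕ-0d Padded-[ 0d ]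
  Padded-0 (suc (suc k)) = surround₀ (Padded-0 k)

  Pal-1 : Pal 1
  Pal-1 = 0 , 1d ∷ [] ,
    record { value = trans (+-identityʳ (toℕ 1d)) toℕ-1d ; leading≢0 = λ _ → 1d≢0 } ,
    λ { zero → refl }

  -- The string is 1, then `k` zeros, then 1.
  Pal-1+d^ : ∀ k → Pal (suc (d ^ suc k))
  Pal-1+d^ k = subst Pal (+-identityʳ _) (Pal-surround₁ (Padded-0 k))

  -- Sums of padded strings of two consecutive lengths.

  PaddedSum : (k x : ℕ) → Set
  PaddedSum k = SumOf (Padded d k) (3 * d)

  PaddedSum-0 : ∀ k → PaddedSum k 0
  PaddedSum-0 k = subst (PaddedSum k) (*-zeroʳ (3 * d)) (SumOf-replicate (3 * d) (Padded-0 k))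

  PaddedSum-1 : ∀ {a} → a ≤ 3 * d → PaddedSum 1 a
  PaddedSum-1 {a} a≤3d = subst (PaddedSum 1) (trans (+-identityʳ (a * 1)) (*-identityʳ a))
    -- The multiplier 0 discards the old values: each empty string is replaced by the single digit 0
    -- or 1.
    (distribute 1 0
      (λ {x} _ → subst (Padded d 1) (sym (*-zeroʳ x)) (Padded-0 1))
      (λ {x} _ → subst (Padded d 1) (trans toℕ-1d (cong suc (sym (*-zeroʳ x)))) Padded-[ 1d ])
      a≤3d (PaddedSum-0 0))

  PaddedSum-+2 : ∀ {k a x} → a ≤ 3 * d → PaddedSum k x →
                 PaddedSum (2 + k) (a * suc (d ^ suc k) + x * d)
  PaddedSum-+2 {k} = distribute (suc (d ^ suc k)) d surround₀ surround₁

  PaddedSum₂ : (k y : ℕ) → Set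
  PaddedSum₂ k y = ∃₂ λ y₁ y₂ → PaddedSum k y₁ × PaddedSum (suc k) y₂ × y ≡ y₁ + y₂

  d≤3d : d ≤ 3 * d
  d≤3d = m≤m+n d (2 * d)

  -- Surrounding lengthens strings by two, hence two base cases. The bound `3 * d ^ suc k` is what
  -- keeps the quotient by `1 + d^k` within the available `3 * d` strings.
  paddedSum₂ : ∀ k {y} → 2 * d ^ k ≤ y → y ≤ 3 * d ^ suc k → PaddedSum₂ k y
  paddedSum₂ zero {y} _ y≤ =
    0 , y , PaddedSum-0 0 , PaddedSum-1 (subst (λ e → y ≤ 3 * e) (*-identityʳ d) y≤) , refl
  -- Division with remainder by `1 + d`: the remainder comes from strings of length 1, the quotient
  -- counts the strings 11.
  paddedSum₂ (suc zero) {y} _ y≤ =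
    a , b * suc D + 0 ,
    PaddedSum-1 (≤-trans a≤D (subst (_≤ 3 * d) (sym (*-identityʳ d)) d≤3d)) ,
    PaddedSum-+2 b≤3d (PaddedSum-0 0) ,
    trans (m≡m%n+[m/n]*n y (suc D)) (cong (a +_) (sym (+-identityʳ _)))
    where
    D = d ^ 1
    a = y % suc D
    b = y / suc D
    a≤D : a ≤ D
    a≤D = ≤-pred (m%n<n y (suc D))
    b≤3d : b ≤ 3 * d
    b≤3d = m≤n*o⇒m/suc[o]≤n y (3 * d) D (≤-trans y≤ (≤-reflexive (sym (*-assoc 3 d D))))
  paddedSum₂ (suc (suc k)) {x} 2q≤x x≤ = extend (paddedSum₂ k 2u≤y y≤3du)
    where
    u = d ^ k
    q = d ^ suc (suc k)
    -- Setting `2 * q` aside before dividing by `1 + q` leaves `w` between `2 * q` and `3 * q`. The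
    -- quotient `b` is the greedy coefficient for length `3 + k`. The coefficient `a` for length
    -- `2 + k` is the residue of `w`, so that `w` minus `a * (1 + d * u)` equals `d * y`.
    z = x ∸ 2 * q
    w = 2 * q + z % suc q
    h = w / d
    a = w % d
    b = z / suc q
    y = h ∸ a * u
    open ≤-Reasoning
    -- The lower bound survives the subtraction of `a * u`: as `2 + a ≤ 1 + d ≤ 2 * d`, failure
    -- would force `w < 2 * q`.
    u[a+2]≤h : u * (2 + a) ≤ h
    u[a+2]≤h = ≮⇒≥ λ h< → <-irrefl refl (begin-strict
      w                        ≡⟨ m≡m%n+[m/n]*n w d ⟩
      a + h * d                <⟨ +-monoˡ-< (h * d) (m%n<n w d) ⟩
      suc h * d                ≤⟨ *-monoˡ-≤ d h< ⟩
      u * (2 + a) * d          ≤⟨ *-monoˡ-≤ d (*-monoʳ-≤ u (s≤s (m%n<n w d))) ⟩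
      u * (1 + d) * d          ≤⟨ *-monoˡ-≤ d (*-monoʳ-≤ u (+-monoˡ-≤ d (≤-trans (s≤s z≤n) 2≤d))) ⟩
      u * (d + d) * d          ≡⟨ rearrange u d ⟩
      2 * q                    ≤⟨ m≤m+n (2 * q) _ ⟩
      w                        ∎)
      where
      rearrange : ∀ u d → u * (d + d) * d ≡ 2 * (d * (d * u))
      rearrange = solve-∀
    2u+au≤h : 2 * u + a * u ≤ h
    2u+au≤h = ≤-trans (≤-reflexive (trans (sym (*-distribʳ-+ u 2 a)) (*-comm (2 + a) u))) u[a+2]≤h
    2u≤y : 2 * u ≤ y
    2u≤y = m+n≤o⇒m≤o∸n (2 * u) 2u+au≤h
    y≤3du : y ≤ 3 * d ^ suc k
    y≤3du = ≤-trans (m∸n≤m h (a * u)) (*-cancelʳ-≤ h _ d (begin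
      h * d              ≤⟨ m/n*n≤m w d ⟩
      2 * q + z % suc q  ≤⟨ +-monoʳ-≤ (2 * q) (≤-pred (m%n<n z (suc q))) ⟩
      2 * q + q          ≡⟨ rearrange u d ⟩
      3 * (d * u) * d    ∎))
      where
      rearrange : ∀ u d → 2 * (d * (d * u)) + d * (d * u) ≡ 3 * (d * u) * d
      rearrange = solve-∀
    au≤h : a * u ≤ h
    au≤h = m+n≤o⇒n≤o (2 * u) 2u+au≤h
    b≤3d : b ≤ 3 * d
    b≤3d = m≤n*o⇒m/suc[o]≤n z (3 * d) q
      (≤-trans (m∸n≤m x (2 * q)) (≤-trans x≤ (≤-reflexive (sym (*-assoc 3 d q)))))
    extend : PaddedSum₂ k y → PaddedSum₂ (2 + k) x
    extend (y₁ , y₂ , s₁ , s₂ , y≡) =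
      a * suc (d ^ suc k) + y₁ * d , b * suc q + y₂ * d ,
      PaddedSum-+2 (≤-trans (<⇒≤ (m%n<n w d)) d≤3d) s₁ , PaddedSum-+2 b≤3d s₂ ,
      (begin-equality
        x                                      ≡⟨ sym (m+[n∸m]≡n 2q≤x) ⟩
        2 * q + z                              ≡⟨ cong (2 * q +_) (m≡m%n+[m/n]*n z (suc q)) ⟩
        2 * q + (z % suc q + b * suc q)        ≡⟨ sym (+-assoc (2 * q) _ _) ⟩
        w + b * suc q                          ≡⟨ cong (_+ b * suc q) (m≡m%n+[m/n]*n w d) ⟩
        a + h * d + b * suc q                  ≡⟨ cong (λ t → a + t * d + b * suc q) (sym (m∸n+n≡m au≤h)) ⟩
        a + (y + a * u) * d + b * suc q        ≡⟨ cong (λ t → a + (t + a * u) * d + b * suc q) y≡ ⟩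
        a + (y₁ + y₂ + a * u) * d + b * suc q  ≡⟨ rearrange a u d b q y₁ y₂ ⟩
        a * suc (d * u) + y₁ * d + (b * suc q + y₂ * d) ∎)
      where
      rearrange : ∀ a u d b q y₁ y₂ → a + (y₁ + y₂ + a * u) * d + b * suc q ≡
                  a * suc (d * u) + y₁ * d + (b * suc q + y₂ * d)
      rearrange = solve-∀

  -- Intervals filled by genuine palindromes.

  -- The contribution of the outer digits 1 of `3 * d` palindromes of length `2 + k` and `3 * d` of
  -- length `3 + k`.
  base : ℕ → ℕ
  base k = 3 * d * suc (d ^ (1 + k)) + 3 * d * suc (d ^ (2 + k))

  -- Above `base k` the surrounded strings give only multiples of `d`. They supply `d` times the
  -- quotient `m / d`, which lies in the range of `paddedSum₂`, and ones supply the residue.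
  blocks : ∀ k {m} → 2 * d ^ (1 + k) ≤ m → m ≤ 3 * d ^ (2 + k) →
           SumOf Pal (3 * d + 3 * d + m % d) (base k + m)
  blocks k {m} 2du≤m m≤ with paddedSum₂ k 2u≤y y≤3du
    where
    2u≤y : 2 * d ^ k ≤ m / d
    2u≤y = subst (_≤ m / d) (m*n/n≡m (2 * d ^ k) d)
      (/-monoˡ-≤ d (subst (_≤ m) (rearrange d (d ^ k)) 2du≤m))
      where
      rearrange : ∀ d u → 2 * (d * u) ≡ 2 * u * d
      rearrange = solve-∀
    y≤3du : m / d ≤ 3 * d ^ suc k
    y≤3du = subst (m / d ≤_) (m*n/n≡m (3 * d ^ suc k) d)
      (/-monoˡ-≤ d (subst (m ≤_) (rearrange d (d ^ suc k)) m≤))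
      where
      rearrange : ∀ d u → 3 * (d * u) ≡ 3 * u * d
      rearrange = solve-∀
  ... | y₁ , y₂ , s₁ , s₂ , y≡ = subst (SumOf Pal _) total
    ((increment (suc (d ^ (1 + k))) d Pal-surround₁ s₁ ++ₛ increment (suc (d ^ (2 + k))) d Pal-surround₁ s₂)
      ++ₛ SumOf-replicate (m % d) Pal-1)
    where
    open ≡-Reasoning
    c₁ = 3 * d * suc (d ^ (1 + k))
    c₂ = 3 * d * suc (d ^ (2 + k))
    total : c₁ + y₁ * d + (c₂ + y₂ * d) + m % d * 1 ≡ c₁ + c₂ + m
    total = begin
      c₁ + y₁ * d + (c₂ + y₂ * d) + m % d * 1  ≡⟨ rearrange c₁ c₂ y₁ y₂ d (m % d) ⟩
      c₁ + c₂ + (m % d + (y₁ + y₂) * d)        ≡⟨ cong (λ y → c₁ + c₂ + (m % d + y * d)) (sym y≡) ⟩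
      c₁ + c₂ + (m % d + m / d * d)            ≡⟨ cong (c₁ + c₂ +_) (sym (m≡m%n+[m/n]*n m d)) ⟩
      c₁ + c₂ + m                              ∎
      where
      rearrange : ∀ c₁ c₂ y₁ y₂ d r → c₁ + y₁ * d + (c₂ + y₂ * d) + r * 1 ≡ c₁ + c₂ + (r + (y₁ + y₂) * d)
      rearrange = solve-∀

  -- Greedy reduction and the thresholds.

  -- Two divisions, by `1 + d^(2+k)` and then by `1 + d^(1+k)`, have quotients at most `14 * d` and
  -- `d`; each lowers the size by one power of `d`.
  greedy : ∀ k z → z ≤ 14 * d ^ (3 + k) →
           ∃[ m ] ∃[ s ] ∃[ r ] m ≤ 15 * d × SumOf Pal m s × r ≤ d ^ (1 + k) × z ≡ s + r
  greedy k z z≤ =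
    t₁ + t₂ , t₁ * suc p + t₂ * suc q , r₂ ,
    subst (t₁ + t₂ ≤_) (+-comm (14 * d) d) (+-mono-≤ t₁≤14d t₂≤d) ,
    SumOf-replicate t₁ (Pal-1+d^ (1 + k)) ++ₛ SumOf-replicate t₂ (Pal-1+d^ k) ,
    ≤-pred (m%n<n r₁ (suc q)) ,
    (begin
      z                                  ≡⟨ m≡m%n+[m/n]*n z (suc p) ⟩
      r₁ + t₁ * suc p                    ≡⟨ cong (_+ t₁ * suc p) (m≡m%n+[m/n]*n r₁ (suc q)) ⟩
      r₂ + t₂ * suc q + t₁ * suc p       ≡⟨ rearrange r₂ (t₂ * suc q) (t₁ * suc p) ⟩
      t₁ * suc p + t₂ * suc q + r₂       ∎)
    where
    open ≡-Reasoning
    p = d ^ (2 + k)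
    q = d ^ (1 + k)
    t₁ = z / suc p
    r₁ = z % suc p
    t₂ = r₁ / suc q
    r₂ = r₁ % suc q
    t₁≤14d : t₁ ≤ 14 * d
    t₁≤14d = m≤n*o⇒m/suc[o]≤n z (14 * d) p (≤-trans z≤ (≤-reflexive (sym (*-assoc 14 d p))))
    t₂≤d : t₂ ≤ d
    t₂≤d = m≤n*o⇒m/suc[o]≤n r₁ d q (≤-pred (m%n<n z (suc p)))
    rearrange : ∀ a b c → a + b + c ≡ c + b + a
    rearrange = solve-∀

  -- Source of the constant 14: the left endpoint of the interval from `blocks` expands into terms
  -- with coefficients 6, 3, 3 and 2, each multiplying a power of `d` that is at most `d^(3+k)`.
  threshold : ∀ k → base k + 2 * d ^ (1 + k) ≤ 14 * d ^ (3 + k)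
  threshold k = begin
    base k + 2 * (d * u)                                          ≡⟨ expand d u ⟩
    6 * (d * 1) + 3 * (d * (d * u)) + 3 * (d * (d * (d * u))) + 2 * (d * u)
      ≤⟨ +-mono-≤ (+-monoˡ-≤ (3 * (d * (d * (d * u)))) (+-mono-≤ (*-monoʳ-≤ 6 d≤p) (*-monoʳ-≤ 3 (*-monoʳ-≤ d (*-monoʳ-≤ d u≤du)))))
                  (*-monoʳ-≤ 2 (*-monoʳ-≤ d (≤-trans u≤du (*-monoʳ-≤ d u≤du)))) ⟩
    6 * p + 3 * p + 3 * p + 2 * p                                 ≡⟨ collect p ⟩
    14 * p                                                        ∎
    where
    open ≤-Reasoning
    u = d ^ k
    p = d ^ (3 + k)
    u≤du : u ≤ d * u
    u≤du = m≤n*m u d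
    d≤p : d * 1 ≤ p
    d≤p = *-monoʳ-≤ d (m^n>0 d (2 + k))
    expand : ∀ d u → 3 * d * suc (d * u) + 3 * d * suc (d * (d * u)) + 2 * (d * u) ≡
             6 * (d * 1) + 3 * (d * (d * u)) + 3 * (d * (d * (d * u))) + 2 * (d * u)
    expand = solve-∀
    collect : ∀ p → 6 * p + 3 * p + 3 * p + 2 * p ≡ 14 * p
    collect = solve-∀

  -- Assembly for every natural number.

  -- The greedy remainder is at most `d` here, so ones finish the sum with at most `16 * d` terms.
  small : ∀ {n} → n ≤ 14 * d ^ 3 → ∃[ m ] m ≤ 22 * d × SumOf Pal m n
  small {n} n≤ with greedy 0 n n≤
  ... | m , s , r , m≤15d , sum-s , r≤ , n≡ =
    m + r ,
    ≤-trans (+-mono-≤ m≤15d (subst (r ≤_) (*-identityʳ d) r≤))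
      (≤-trans (≤-reflexive (+-comm (15 * d) d)) (*-monoˡ-≤ d (m≤m+n 16 6))) ,
    subst (SumOf Pal (m + r)) (trans (cong (s +_) (*-identityʳ r)) (sym n≡))
      (sum-s ++ₛ SumOf-replicate r Pal-1)

  -- The constant 22 arises as 3 + 3 for the two lengths of blocks, 1 for the ones and 15 for the
  -- greedy part.
  large : ∀ k {n} → 14 * d ^ (3 + k) ≤ n → n ≤ 14 * d ^ (4 + k) → ∃[ m ] m ≤ 22 * d × SumOf Pal m n
  -- The left endpoint is removed before the greedy step. Index `suc k` gives a remainder at most
  -- `d^(2+k)`, which still fits in the interval of `blocks k` when added back to `2 * d ^ (1 + k)`.
  large k {n} ≤n n≤ with greedy (suc k) (n ∸ (base k + 2 * d ^ (1 + k))) (≤-trans (m∸n≤m n (base k + 2 * d ^ (1 + k))) n≤)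
  ... | m , s , r , m≤15d , sum-s , r≤ , eq =
    3 * d + 3 * d + (2 * d ^ (1 + k) + r) % d + m ,
    (begin
      3 * d + 3 * d + (2 * d ^ (1 + k) + r) % d + m
        ≤⟨ +-mono-≤ (+-monoʳ-≤ (3 * d + 3 * d) (<⇒≤ (m%n<n (2 * d ^ (1 + k) + r) d))) m≤15d ⟩
      3 * d + 3 * d + d + 15 * d  ≡⟨ collect d ⟩
      22 * d                      ∎) ,
    subst (SumOf Pal _) total (blocks k (m≤m+n (2 * d ^ (1 + k)) r) upper ++ₛ sum-s)
    where
    open ≤-Reasoning
    collect : ∀ d → 3 * d + 3 * d + d + 15 * d ≡ 22 * d
    collect = solve-∀
    upper : 2 * d ^ (1 + k) + r ≤ 3 * d ^ (2 + k)
    upper = begin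
      2 * d ^ (1 + k) + r            ≤⟨ +-mono-≤ (*-monoʳ-≤ 2 (m≤n*m (d ^ (1 + k)) d)) r≤ ⟩
      2 * d ^ (2 + k) + d ^ (2 + k)  ≡⟨ +-comm (2 * d ^ (2 + k)) _ ⟩
      3 * d ^ (2 + k)                ∎
    total : base k + (2 * d ^ (1 + k) + r) + s ≡ n
    total = begin-equality
      base k + (2 * d ^ (1 + k) + r) + s  ≡⟨ rearrange (base k) (2 * d ^ (1 + k)) r s ⟩
      base k + 2 * d ^ (1 + k) + (s + r)  ≡⟨ cong (base k + 2 * d ^ (1 + k) +_) (sym eq) ⟩
      base k + 2 * d ^ (1 + k) + (n ∸ (base k + 2 * d ^ (1 + k)))
                                          ≡⟨ m+[n∸m]≡n (≤-trans (threshold k) ≤n) ⟩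
      n                                   ∎
      where
      rearrange : ∀ b c r s → b + (c + r) + s ≡ b + c + (s + r)
      rearrange = solve-∀

  sumOfPalindromes : ∀ n → ∃[ m ] m ≤ 22 * d × SumOf Pal m n
  -- The index `n` is a safe start for the search, since `n < d ^ n`.
  sumOfPalindromes n with bracket (λ k → 14 * d ^ (3 + k)) n n n<
    where
    n< : n < 14 * d ^ (3 + n)
    n< = <-≤-trans (n<m^n d 2≤d n)
      (≤-trans (^-monoʳ-≤ d (m≤n+m n 3)) (m≤m+n (d ^ (3 + n)) (13 * d ^ (3 + n))))
  ... | inj₁ n<            = small (<⇒≤ n<)
  ... | inj₂ (k , ≤n , n<) = large k ≤n (<⇒≤ n<)

theorem1 : ∃[ C ] 0 < C × (∀ (d : ℕ) → 2 ≤ d → ∀ (n : ℕ) → IsSumOfAtMostPalindromes d (C * d) n)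
theorem1 = 22 , s≤s z≤n , bound
  where
  bound : ∀ d → 2 ≤ d → ∀ n → IsSumOfAtMostPalindromes d (22 * d) n
  bound d 2≤d n with Base.sumOfPalindromes d 2≤d n
  ... | m , m≤22d , s with SumOf⇒palindromes s
  ... | ps , len , pals , eq = ps , ≤-trans (≤-reflexive len) m≤22d , pals , eq
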